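{- If a Sudoku grid $\mathcal{A}$ has a unique solution, then this solution is a logically deducible solution of $\mathcal{A}$.
   Context: A Sudoku proposition is a formal symbol $r_ic_j \not\approx d$ with $i,j,d\in\{1,\dots,9\}$. Sudoku formulas are built inductively from Sudoku propositions and the constants $\top,\bot$ using $\lnot,\land,\lor,\Rightarrow,\Leftrightarrow$. A grid is a $9\times 9$ matrix $\mathcal{A}=[A_{ij}]_{9\times 9}$ of nonempty subsets $A_{ij}\subseteq\{1,\dots,9\}$; it is full if $|A_{ij}|=1$ for all $i,j$. Satisfaction $\mathcal{A}\models\phi$: $\mathcal{A}\models\top$ always, $\mathcal{A}\models\bot$ never, $\mathcal{A}\models r_ic_j\not\approx d$ iff $d\notin A_{ij}$, and the connectives are interpreted classically. Write $r_ic_j\equiv d$ for $\bigwedge_{s\ne d} r_ic_j\not\approx s$, and $r_ic_j\parallel r_\ell c_m$ for $\bigwedge_{1\le d\le 9}((r_ic_j\equiv d\Rightarrow r_\ell c_m\not\approx d)\land(r_\ell c_m\equiv d\Rightarrow r_ic_j\not\approx d))$. The set $\Sigma_{ax}$ consists of 27 formulas, one for each row, each column and each of the nine standard $3\times 3$ boxes: the conjunction of $r_ic_j\parallel r_\ell c_m$ over all pairs of distinct cells in that row, column or box. A Sudoku grid is a grid $\mathcal{A}$ with $\mathcal{A}\models\phi$ for all $\phi\in\Sigma_{ax}$ (i.e. whenever $A_{ij}=\{d\}$, $d$ belongs to no $A_{\ell m}$ for another cell in the same row, column or box). A full Sudoku grid is a Sudoku grid that is full. A solution of a Sudoku grid $\mathcal{A}=[A_{ij}]$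 is a full Sudoku grid $\mathcal{S}=[S_{ij}]$ with $S_{ij}\subseteq A_{ij}$ for all $i,j$. A Sudoku axiom is a Sudoku formula that holds in every full Sudoku grid; $\Delta_{ax}$ is the set of all Sudoku axioms. For a set $\Phi$ of Sudoku formulas and a Sudoku formula $\alpha$, $\Phi\vdash\alpha$ means there is a finite sequence $\phi_1,\dots,\phi_n=\alpha$ of Sudoku formulas such that each $\phi_i$ is in $\Delta_{ax}$, or in $\Phi$, or is obtained by modus ponens from earlier formulas (there are $p,q<i$ with $\phi_q$ equal to $\phi_p\Rightarrow\phi_i$). $\Phi\vdash\Psi$ means $\Phi\vdash\alpha$ for all $\alpha\in\Psi$. For a Sudoku grid $\mathcal{A}$ let $\mathrm{Prop}(\mathcal{A})=\{r_ic_j\not\approx d: 1\le i,j,d\le 9,\ d\notin A_{ij}\}$. A solution $\mathcal{S}$ of $\mathcal{A}$ is a logically deducible solution of $\mathcal{A}$ if $\mathrm{Prop}(\mathcal{A})\vdash\mathrm{Prop}(\mathcal{S})$. -}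

module Defs where

open import Data.Nat.Base using (ℕ; suc)
open import Data.Fin.Base using (Fin; combine; fromℕ; _<_)
open import Data.Fin.Properties using (_≟_)
open import Data.Fin.Subset using (Subset; Nonempty; ∣_∣; _∉_; _⊆_)
open import Data.Fin.Subset.Properties using (_∈?_)
open import Data.List.Base using (List; map; foldr; filter; allFin; cartesianProduct)
open import Data.Product using (_×_; _,_; ∃-syntax; uncurry)
open import Data.Product.Properties using (≡-dec)
open import Data.Sum.Base using (_⊎_)
open import Data.Unit.Base using (⊤)
open import Data.Empty using (⊥)
open import Level using (0ℓ)
open import Relation.Binary.PropositionalEquality using (_≡_)
open import Relation.Nullary.Decidable using (Dec; yes; no; ¬?; _×-dec_; _⊎-dec_; _→-dec_)
open import Relation.Nullary.Negation using (¬_)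
open import Relation.Unary as Pred using (Pred)

-- Rows, columns and digits 1, …, 9 are all represented by Fin 9 (0, …, 8).

infix  25 r_c_≉_ r_c_≡ᶠ_
infix  24 ¬ᶠ_
infixr 23 _∧ᶠ_
infixr 22 _∨ᶠ_
infixr 21 _⇒ᶠ_
infix  20 _⇔ᶠ_

data Formula : Set where
  r_c_≉_              : (i j d : Fin 9) → Formula
  ⊤ᶠ ⊥ᶠ               : Formula
  ¬ᶠ_                 : Formula → Formula
  _∧ᶠ_ _∨ᶠ_ _⇒ᶠ_ _⇔ᶠ_ : Formula → Formula → Formula

record Grid : Set where
  field
    cell     : (i j : Fin 9) → Subset 9
    nonempty : ∀ i j → Nonempty (cell i j)

open Grid public

-- Equality of the underlying matrices: a Nonempty proof carries a choice of
-- element, so _≡_ on Grid would be too fine.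
infix 4 _≈_
_≈_ : Grid → Grid → Set
A ≈ B = ∀ i j → cell A i j ≡ cell B i j

IsFull : Grid → Set
IsFull A = ∀ i j → ∣ cell A i j ∣ ≡ 1

infix 4 _⊨_ _⊨?_

_⊨_ : Grid → Formula → Set
A ⊨ r i c j ≉ d = d ∉ cell A i j
A ⊨ ⊤ᶠ          = ⊤
A ⊨ ⊥ᶠ          = ⊥
A ⊨ ¬ᶠ φ        = ¬ (A ⊨ φ)
A ⊨ φ ∧ᶠ ψ      = A ⊨ φ × A ⊨ ψ
A ⊨ φ ∨ᶠ ψ      = A ⊨ φ ⊎ A ⊨ ψ
A ⊨ φ ⇒ᶠ ψ      = A ⊨ φ → A ⊨ ψ
A ⊨ φ ⇔ᶠ ψ      = (A ⊨ φ → A ⊨ ψ) × (A ⊨ ψ → A ⊨ φ)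

-- Satisfaction is decidable, so the clauses above agree with the classical
-- truth tables.
_⊨?_ : ∀ A φ → Dec (A ⊨ φ)
A ⊨? r i c j ≉ d = ¬? (d ∈? cell A i j)
A ⊨? ⊤ᶠ          = yes _
A ⊨? ⊥ᶠ          = no λ ()
A ⊨? ¬ᶠ φ        = ¬? (A ⊨? φ)
A ⊨? φ ∧ᶠ ψ      = (A ⊨? φ) ×-dec (A ⊨? ψ)
A ⊨? φ ∨ᶠ ψ      = (A ⊨? φ) ⊎-dec (A ⊨? ψ)
A ⊨? φ ⇒ᶠ ψ      = (A ⊨? φ) →-dec (A ⊨? ψ)
A ⊨? φ ⇔ᶠ ψ      = ((A ⊨? φ) →-dec (A ⊨? ψ)) ×-dec ((A ⊨? ψ) →-dec (A ⊨? φ))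

⋀ : List Formula → Formula
⋀ = foldr _∧ᶠ_ ⊤ᶠ

r_c_≡ᶠ_ : (i j d : Fin 9) → Formula
r i c j ≡ᶠ d = ⋀ (map (r i c j ≉_) (filter (λ s → ¬? (s ≟ d)) (allFin 9)))

Cell : Set
Cell = Fin 9 × Fin 9

_∥_ : Cell → Cell → Formula
(i , j) ∥ (l , m) = ⋀ (map clause (allFin 9))
  where
  clause : Fin 9 → Formula
  clause d = (r i c j ≡ᶠ d ⇒ᶠ r l c m ≉ d) ∧ᶠ (r l c m ≡ᶠ d ⇒ᶠ r i c j ≉ d)

rowCells columnCells : Fin 9 → List Cell
rowCells    i = map (λ j → i , j) (allFin 9)
columnCells j = map (λ i → i , j) (allFin 9)

-- combine a x : Fin 9 has value 3a + x, so (a , b) locates the box and (x , y)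
-- a cell inside it.
boxCells : Fin 3 × Fin 3 → List Cell
boxCells (a , b) = map (λ (x , y) → combine a x , combine b y)
                       (cartesianProduct (allFin 3) (allFin 3))

distinctPairs : List Cell → List (Cell × Cell)
distinctPairs u = filter (λ (x , y) → ¬? (≡-dec _≟_ _≟_ x y)) (cartesianProduct u u)

unitAxiom : List Cell → Formula
unitAxiom u = ⋀ (map (uncurry _∥_) (distinctPairs u))

data IsUnit : Pred (List Cell) 0ℓ where
  row    : ∀ i → IsUnit (rowCells i)
  column : ∀ j → IsUnit (columnCells j)
  box    : ∀ b → IsUnit (boxCells b)

Σax : Pred Formula 0ℓ
Σax φ = ∃[ u ] IsUnit u × φ ≡ unitAxiom u

IsSudokuGrid : Grid → Set
IsSudokuGrid A = ∀ φ → φ Pred.∈ Σax → A ⊨ φ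

IsFullSudokuGrid : Grid → Set
IsFullSudokuGrid A = IsSudokuGrid A × IsFull A

_IsSolutionOf_ : Grid → Grid → Set
S IsSolutionOf A = IsFullSudokuGrid S × (∀ i j → cell S i j ⊆ cell A i j)

Δax : Pred Formula 0ℓ
Δax φ = ∀ A → IsFullSudokuGrid A → A ⊨ φ

infix 4 _⊢_ _⊢*_

-- The derivation is the sequence φ₀, …, φₙ; Fin (suc n) makes it nonempty, and
-- fromℕ n is its last index.
record _⊢_ (Φ : Pred Formula 0ℓ) (α : Formula) : Set where
  field
    n         : ℕ
    φ         : Fin (suc n) → Formula
    last      : φ (fromℕ n) ≡ α
    justified : ∀ i → φ i Pred.∈ Δax
                    ⊎ φ i Pred.∈ Φ
                    ⊎ ∃[ p ] ∃[ q ] p < i × q < i × φ q ≡ (φ p ⇒ᶠ φ i)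

_⊢*_ : Pred Formula 0ℓ → Pred Formula 0ℓ → Set
Φ ⊢* Ψ = ∀ α → α Pred.∈ Ψ → Φ ⊢ α

Prop : Grid → Pred Formula 0ℓ
Prop A φ = ∃[ i ] ∃[ j ] ∃[ d ] d ∉ cell A i j × φ ≡ r i c j ≉ d

_IsLogicallyDeducibleSolutionOf_ : Grid → Grid → Set
S IsLogicallyDeducibleSolutionOf A = S IsSolutionOf A × Prop A ⊢* Prop S

{-# OPTIONS --safe #-}

-- Prop(A) is a finite set {γ₁, …, γₙ}, and a full Sudoku grid satisfying all the
-- γₖ is a solution of A, hence equal to S when S is the only one.  So for
-- α ∈ Prop(S) the formula γ₁ ⇒ … ⇒ γₙ ⇒ α holds in every full Sudoku grid,
-- i.e. it is a Sudoku axiom, and n applications of modus ponens give α.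
module Submission where

open import Data.Fin.Base using (Fin; zero; suc; fromℕ; inject₁; _<_)
open import Data.Fin.Properties using (toℕ-inject₁; toℕ-fromℕ; toℕ<n)
open import Data.Fin.Relation.Unary.Top using (view; ‵fromℕ; ‵inject₁; view-fromℕ; view-inject₁)
open import Data.Fin.Subset using (_⊆_; _∉_)
open import Data.Fin.Subset.Properties using (_∈?_)
open import Data.List.Base using (List; []; _∷_; map; foldr; filter; allFin; cartesianProduct)
open import Data.List.Membership.Propositional using (_∈_)
open import Data.List.Membership.Propositional.Properties
  using (∈-allFin; ∈-cartesianProduct⁺; ∈-filter⁺; ∈-filter⁻; ∈-map⁺; ∈-map⁻)
open import Data.List.Relation.Unary.All as All using (All; []; _∷_)
open import Data.Nat.Base as ℕ using (ℕ; suc; z<s; s<s)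
open import Data.Product using (_×_; _,_; ∃!; ∃-syntax; proj₁)
open import Data.Sum.Base using (_⊎_; inj₁; inj₂)
open import Function.Base using (_∘_)
open import Level using (0ℓ)
open import Relation.Binary.PropositionalEquality
open import Relation.Nullary.Decidable using (¬?; decidable-stable)
open import Relation.Unary as Pred using (Pred)
open import Defs

private variable
  m n : ℕ
  X   : Set
  Φ   : Pred Formula 0ℓ
  α β : Formula

-- A derivation has its conclusion at the last index, so it grows at the end of `Fin (suc n)`, where
-- matching on `zero` and `suc` does not help. `view` separates off `fromℕ n` instead.
inject₁-fromℕ-elim : (P : Fin (suc n) → Set) → (∀ j → P (inject₁ j)) → P (fromℕ n) → ∀ i → P i
inject₁-fromℕ-elim P step top i with view i
... | ‵fromℕ     = top
... | ‵inject₁ j = step j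

snoc : (Fin n → X) → X → Fin (suc n) → X
snoc {X = X} f x = inject₁-fromℕ-elim (λ _ → X) f x

-- `view` is stuck on `fromℕ n` for a variable `n`, so `snoc` computes only up to a propositional
-- equality.
snoc-fromℕ : (f : Fin n → X) (x : X) → snoc f x (fromℕ n) ≡ x
snoc-fromℕ {n} f x rewrite view-fromℕ n = refl

snoc-inject₁ : (f : Fin n → X) (x : X) (j : Fin n) → snoc f x (inject₁ j) ≡ f j
snoc-inject₁ f x j rewrite view-inject₁ j = refl

inject₁-mono-< : {i j : Fin n} → i < j → inject₁ i < inject₁ j
inject₁-mono-< {i = i} {j} = subst₂ ℕ._<_ (sym (toℕ-inject₁ i)) (sym (toℕ-inject₁ j))

inject₁<fromℕ : (i : Fin n) → inject₁ i < fromℕ n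
inject₁<fromℕ {n} i = subst₂ ℕ._<_ (sym (toℕ-inject₁ i)) (sym (toℕ-fromℕ n)) (toℕ<n i)

-- The condition in the field `justified`, freed from `_⊢_` so that it also applies to intermediate
-- sequences.
Justified : Pred Formula 0ℓ → (Fin n → Formula) → Fin n → Set
Justified Φ φ i = φ i Pred.∈ Δax
                ⊎ φ i Pred.∈ Φ
                ⊎ ∃[ p ] ∃[ q ] p < i × q < i × φ q ≡ (φ p ⇒ᶠ φ i)

-- Monotonicity of `e` keeps the premises of a modus ponens step earlier than its conclusion; `eq`
-- keeps the formulas themselves.
justified-embed : {φ : Fin m → Formula} {ψ : Fin n → Formula} (e : Fin m → Fin n) →
  (∀ {i j} → i < j → e i < e j) → (∀ i → ψ (e i) ≡ φ i) →
  ∀ i → Justified Φ φ i → Justified Φ ψ (e i)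
justified-embed e mono eq i (inj₁ ax)         = inj₁ (subst Δax (sym (eq i)) ax)
justified-embed {Φ = Φ} e mono eq i (inj₂ (inj₁ hyp)) = inj₂ (inj₁ (subst Φ (sym (eq i)) hyp))
justified-embed e mono eq i (inj₂ (inj₂ (p , q , p<i , q<i , φq≡))) =
  inj₂ (inj₂ (e p , e q , mono p<i , mono q<i ,
    trans (eq q) (trans φq≡ (sym (cong₂ _⇒ᶠ_ (eq p) (eq i))))))

⊢-axiom : α Pred.∈ Δax → Φ ⊢ α
⊢-axiom {α} ax = record
  { n = 0 ; φ = λ _ → α ; last = refl ; justified = λ _ → inj₁ ax }

-- As `α` is a hypothesis, one line suffices to derive it: put `α` before the given derivation and
-- `β` after it.
⊢-modusPonens : α Pred.∈ Φ → Φ ⊢ (α ⇒ᶠ β) → Φ ⊢ β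
⊢-modusPonens {α} {Φ} {β} α∈Φ d = record
  { n = suc (suc (_⊢_.n d)) ; φ = ψ ; last = snoc-fromℕ α∷φ β ; justified = ψ-justified }
  where
  open _⊢_ d renaming (n to k)

  α∷φ : Fin (suc (suc k)) → Formula
  α∷φ zero    = α
  α∷φ (suc i) = φ i

  α∷φ-justified : ∀ i → Justified Φ α∷φ i
  α∷φ-justified zero    = inj₂ (inj₁ α∈Φ)
  α∷φ-justified (suc i) = justified-embed {Φ = Φ} suc s<s (λ _ → refl) i (justified i)

  ψ : Fin (suc (suc (suc k))) → Formula
  ψ = snoc α∷φ β

  ψ-justified : ∀ i → Justified Φ ψ i
  ψ-justified = inject₁-fromℕ-elim (Justified Φ ψ)
    (λ j → justified-embed {Φ = Φ} inject₁ inject₁-mono-< (snoc-inject₁ α∷φ β)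
                                   j (α∷φ-justified j))
    -- The premises of `β` are `α` at the front and `α ⇒ᶠ β`, the end of the old derivation and the
    -- last entry of `α∷φ`.
    (inj₂ (inj₂ (zero , inject₁ (fromℕ (suc k)) , z<s , inject₁<fromℕ (fromℕ (suc k)) ,
      trans (snoc-inject₁ α∷φ β (fromℕ (suc k)))
        (trans last (cong (α ⇒ᶠ_) (sym (snoc-fromℕ α∷φ β)))))))

-- Satisfaction reads `⇒ᶠ` as a function space, so this is currying along `Γ`.
⊨-foldr-⇒ : ∀ B Γ → (All (B ⊨_) Γ → B ⊨ α) → B ⊨ foldr _⇒ᶠ_ α Γ
⊨-foldr-⇒ B []      h   = h []
⊨-foldr-⇒ B (γ ∷ Γ) h b = ⊨-foldr-⇒ B Γ (h ∘ (b ∷_))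

⊢-discharge : ∀ {Γ} → All Φ Γ → Φ ⊢ foldr _⇒ᶠ_ α Γ → Φ ⊢ α
⊢-discharge []         d = d
⊢-discharge (γ∈Φ ∷ Γ⊆Φ) d = ⊢-discharge Γ⊆Φ (⊢-modusPonens γ∈Φ d)

-- Completeness with respect to full Sudoku grids: as `Γ` is finite, the entailment is expressed by
-- a single formula, and that formula lies in `Δax`.
⊢-complete : ∀ {Γ} → All Φ Γ → (∀ B → IsFullSudokuGrid B → All (B ⊨_) Γ → B ⊨ α) → Φ ⊢ α
⊢-complete {Γ = Γ} Γ⊆Φ h =
  ⊢-discharge Γ⊆Φ (⊢-axiom λ B full → ⊨-foldr-⇒ B Γ (h B full))

module _ (A : Grid) where

  private
    excluded? : Pred.Decidable {A = Fin 9 × Fin 9 × Fin 9} (λ (i , j , d) → d ∉ cell A i j)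
    excluded? (i , j , d) = ¬? (d ∈? cell A i j)

    triples : List (Fin 9 × Fin 9 × Fin 9)
    triples = cartesianProduct (allFin 9) (cartesianProduct (allFin 9) (allFin 9))

  propList : List Formula
  propList = map (λ (i , j , d) → r i c j ≉ d) (filter excluded? triples)

  propList⊆Prop : All (Prop A) propList
  propList⊆Prop = All.tabulate λ φ∈ → let (i , j , d) , t∈ , eq = ∈-map⁻ _ φ∈
                                          _ , d∉ = ∈-filter⁻ excluded? {xs = triples} t∈
                                      in i , j , d , d∉ , eq

  ∈-propList : ∀ {i j d} → d ∉ cell A i j → r i c j ≉ d ∈ propList
  ∈-propList {i} {j} {d} d∉ = ∈-map⁺ _ (∈-filter⁺ excluded?
    (∈-cartesianProduct⁺ (∈-allFin i) (∈-cartesianProduct⁺ (∈-allFin j) (∈-allFin d))) d∉)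

  ⊨propList⇒⊆ : ∀ B → All (B ⊨_) propList → ∀ i j → cell B i j ⊆ cell A i j
  -- A digit of `B` missing from `A` would violate one of the listed formulas; decidable membership
  -- turns this refutation into membership.
  ⊨propList⇒⊆ B B⊨ i j {d} d∈B = decidable-stable (d ∈? cell A i j)
    λ d∉A → All.lookup B⊨ (∈-propList d∉A) d∈B

theorem5p11 : (A : Grid) → IsSudokuGrid A →
    (unique : ∃! _≈_ (_IsSolutionOf A)) →
    proj₁ unique IsLogicallyDeducibleSolutionOf A
theorem5p11 A _ (S , S-solves , S-unique) = S-solves , λ where
  _ (i , j , d , d∉S , refl) → ⊢-complete (propList⊆Prop A) λ B full B⊨ →
    -- `B` solves `A`, so uniqueness identifies its cells with those of `S`, and `d` is absent from
    -- `B` as well.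
    subst (d ∉_) (S-unique {B} (full , ⊨propList⇒⊆ A B B⊨) i j) d∉S
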